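{- (1) Let $\mathsf{L}$ and $\mathsf{L}'$ be simplicial complexes. (i) If $\mathrm{C}(\mathsf{L}';\mathsf{H})>\mathrm{C}(\mathsf{L};\mathsf{H})$ for some simplicial complex $\mathsf{H}$, then there is no facet simplicial map from $\mathsf{L}'$ to $\mathsf{L}$. (ii) If $\mathrm{IC}(\mathsf{L}';\mathsf{H})>\mathrm{IC}(\mathsf{L};\mathsf{H})$ for some simplicial complex $\mathsf{H}$, then there is no injective facet simplicial map from $\mathsf{L}'$ to $\mathsf{L}$. (2) Let $\mathsf{H}$ and $\mathsf{H}'$ be simplicial complexes. (i) If $\mathrm{C}(\mathsf{L};\mathsf{H})>\mathrm{C}(\mathsf{L};\mathsf{H}')$ for some simplicial complex $\mathsf{L}$, then there is no facet simplicial map from $\mathsf{H}'$ to $\mathsf{H}$. (ii) If $\mathrm{IC}(\mathsf{L};\mathsf{H})>\mathrm{IC}(\mathsf{L};\mathsf{H}')$ for some simplicial complex $\mathsf{L}$, then there is no injective facet simplicial map from $\mathsf{H}'$ to $\mathsf{H}$.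
   Context: A simplicial complex is an abstract simplicial complex: a set $\mathsf{K}$ of subsets (simplices) of a vertex set $V(\mathsf{K})=\bigcup\mathsf{K}$ such that $F\in\mathsf{K}$ and $G\subseteq F$ imply $G\in\mathsf{K}$. A facet is a simplex that is maximal with respect to inclusion; a facet is non-unitary if it has at least two vertices. A subcomplex of $\mathsf{K}$ is a simplicial complex contained in $\mathsf{K}$. The union of simplicial complexes is the union of their vertex sets and of their sets of simplices. A simplicial map $f:\mathsf{L}\to\mathsf{K}$ is a map $f:V(\mathsf{L})\to V(\mathsf{K})$ such that $f(F)\in\mathsf{K}$ whenever $F\in\mathsf{L}$; it is injective if it is injective on vertices. A facet simplicial map is a simplicial map $f:\mathsf{L}\to\mathsf{K}$ such that $f(F)$ is a non-unitary facet of $\mathsf{K}$ whenever $F$ is a non-unitary facet of $\mathsf{L}$. The facet-complexity $\mathrm{C}(\mathsf{L};\mathsf{K})$ is the least positive integer $k$ such that there exist subcomplexes $\mathsf{L}_1,\ldots,\mathsf{L}_k$ of $\mathsf{L}$ with $\mathsf{L}=\mathsf{L}_1\cup\cdots\cup\mathsf{L}_k$ and, for each $i$, a facet simplicial map $f_i:\mathsf{L}_i\to\mathsf{K}$; it is $\infty$ if no such $k$ exists. The injective facet-complexity $\mathrm{IC}(\mathsf{L};\mathsf{K})$ is defined in the same way, requiring each $f_i$ to be an injective facet simplicial map. -}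

module Defs where

open import Axiom.ExcludedMiddle using (ExcludedMiddle)
open import Data.Fin.Base using (Fin)
import Data.Irrelevant as Irr
open import Data.Nat.Base using (ℕ; _<_; _≤_)
open import Data.Nat.Induction using (<-rec)
open import Data.Nat.Properties using (≮⇒≥)
open import Data.Product.Base using (Σ-syntax; ∃; ∃-syntax; _×_; _,_; proj₁)
import Data.Refinement as Ref
open import Data.Refinement using (Refinement)
open import Function.Definitions using (Injective)
open import Level using (Level; suc)
open import Relation.Binary.Construct.Add.Supremum.Strict _<_ using (_<⁺_)
open import Relation.Binary.PropositionalEquality.Core using (_≡_; _≢_)
open import Relation.Nullary using (¬_; yes; no)
open import Relation.Nullary.Construct.Add.Supremum using (_⁺; ⊤⁺; [_])
open import Relation.Unary using (Pred; _∈_; _⊆_; _≐_)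

private
  variable
    ℓ p : Level
    U W : Set ℓ

-- A complex whose simplices are subsets of an ambient type U.  The ambient
-- type is not the vertex set: the vertex set is the union of the simplices
-- (see Vertex), so that subcomplexes may share U and yet have fewer vertices.
-- Subsets are predicates, identified when they have the same elements;
-- down-closure makes `simplices` invariant under this identification.
record SimplicialComplex {ℓ} (U : Set ℓ) : Set (suc ℓ) where
  field
    simplices   : Pred (Pred U ℓ) ℓ
    down-closed : ∀ {F G} → F ∈ simplices → G ⊆ F → G ∈ simplices

open SimplicialComplex public

IsVertex : {U : Set ℓ} → SimplicialComplex U → Pred U (suc ℓ)
IsVertex K v = ∃[ F ] (F ∈ simplices K × v ∈ F)

-- Being a vertex is recorded irrelevantly, so two vertices are equal as soon
-- as their underlying elements of U are.
Vertex : {U : Set ℓ} → SimplicialComplex U → Set (suc ℓ)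
Vertex {U = U} K = Refinement U (IsVertex K)

vertexOf : {U : Set ℓ} (K : SimplicialComplex U) {F : Pred U ℓ} →
           F ∈ simplices K → ∀ {v} → v ∈ F → Vertex K
vertexOf K {F} F∈K {v} v∈F = v Ref., Irr.[ F , F∈K , v∈F ]

IsFacet : {U : Set ℓ} → SimplicialComplex U → Pred (Pred U ℓ) (suc ℓ)
IsFacet K F = F ∈ simplices K × (∀ {G} → G ∈ simplices K → F ⊆ G → G ⊆ F)

NonUnitary : {U : Set ℓ} → Pred (Pred U ℓ) ℓ
NonUnitary F = ∃[ v ] ∃[ w ] (v ∈ F × w ∈ F × v ≢ w)

IsNonUnitaryFacet : {U : Set ℓ} → SimplicialComplex U → Pred (Pred U ℓ) (suc ℓ)
IsNonUnitaryFacet K F = IsFacet K F × NonUnitary F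

_IsSubcomplexOf_ : {U : Set ℓ} → SimplicialComplex U → SimplicialComplex U → Set (suc ℓ)
M IsSubcomplexOf L = simplices M ⊆ simplices L

-- The vertex set of ⋃ Ls is automatically the union of the vertex sets.
⋃ : {U : Set ℓ} {k : ℕ} → (Fin k → SimplicialComplex U) → SimplicialComplex U
⋃ Ls .simplices   F             = ∃[ i ] (F ∈ simplices (Ls i))
⋃ Ls .down-closed (i , F∈Lᵢ) G⊆F = i , down-closed (Ls i) F∈Lᵢ G⊆F

-- The image f(F) of a simplex F of L; the proof that F is a simplex is what
-- makes its elements vertices, hence arguments of f.
image : {U W : Set ℓ} (L : SimplicialComplex U) (K : SimplicialComplex W) →
        (Vertex L → Vertex K) → {F : Pred U ℓ} → F ∈ simplices L → Pred W ℓ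
image {U = U} L K f {F} F∈L w =
  Σ[ v ∈ U ] Σ[ v∈F ∈ v ∈ F ] Ref.value (f (vertexOf L F∈L v∈F)) ≡ w

record FacetSimplicialMap {ℓ} {U W : Set ℓ}
  (L : SimplicialComplex U) (K : SimplicialComplex W) : Set (suc ℓ) where
  field
    map        : Vertex L → Vertex K
    simplicial : ∀ {F} (F∈L : F ∈ simplices L) → image L K map F∈L ∈ simplices K
    facet      : ∀ {F} (F∈L : F ∈ simplices L) → IsNonUnitaryFacet L F →
                 IsNonUnitaryFacet K (image L K map F∈L)

record InjectiveFacetSimplicialMap {ℓ} {U W : Set ℓ}
  (L : SimplicialComplex U) (K : SimplicialComplex W) : Set (suc ℓ) where
  field
    facetSimplicialMap : FacetSimplicialMap L K
  open FacetSimplicialMap facetSimplicialMap public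
  field
    injective : Injective _≡_ _≡_ map

-- L is the union of k subcomplexes, each of which satisfies P.
Decomposition : {U : Set ℓ} → (SimplicialComplex U → Set (suc ℓ)) →
                SimplicialComplex U → ℕ → Set (suc ℓ)
Decomposition {U = U} P L k =
  Σ[ Ls ∈ (Fin k → SimplicialComplex U) ]
    ((∀ i → Ls i IsSubcomplexOf L) ×
     simplices L ≐ simplices (⋃ Ls) ×
     (∀ i → P (Ls i)))

-- ℕ ⁺ is ℕ with a top element ∞ = ⊤⁺ adjoined.
IsLeastPositive : (ℕ → Set p) → ℕ ⁺ → Set p
IsLeastPositive P [ k ] = (0 < k × P k) × (∀ j → 0 < j × P j → k ≤ j)
IsLeastPositive P ⊤⁺    = ∀ k → ¬ (0 < k × P k)

-- The least element of an arbitrary set of positive integers, or ∞ if there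
-- is none, exists only classically.
leastPositive : ExcludedMiddle p → (P : ℕ → Set p) → ∃ (IsLeastPositive P)
leastPositive {p} em P with em {∃[ k ] (0 < k × P k)}
... | no none     = ⊤⁺ , λ k q → none (k , q)
... | yes (k , q) = <-rec (λ k → 0 < k × P k → ∃ (IsLeastPositive P)) step k q
  where
  step : ∀ k → (∀ {j} → j < k → 0 < j × P j → ∃ (IsLeastPositive P)) →
         0 < k × P k → ∃ (IsLeastPositive P)
  step k rec q with em {∃[ j ] (j < k × (0 < j × P j))}
  ... | yes (j , j<k , r) = rec j<k r
  ... | no none           = [ k ] , q , λ j r → ≮⇒≥ λ j<k → none (j , j<k , r)

C : ExcludedMiddle (suc ℓ) → {U W : Set ℓ} →
    SimplicialComplex U → SimplicialComplex W → ℕ ⁺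
C em L K = proj₁ (leastPositive em (Decomposition (λ M → FacetSimplicialMap M K) L))

IC : ExcludedMiddle (suc ℓ) → {U W : Set ℓ} →
     SimplicialComplex U → SimplicialComplex W → ℕ ⁺
IC em L K = proj₁ (leastPositive em (Decomposition (λ M → InjectiveFacetSimplicialMap M K) L))

infix 4 _>⁺_
_>⁺_ : ℕ ⁺ → ℕ ⁺ → Set
m >⁺ n = n <⁺ m

{-# OPTIONS --safe #-}
-- Post-composition with a facet simplicial map settles (2).  For (1), let
-- f : L′ → L be a facet simplicial map and L = L₁ ∪ ⋯ ∪ Lₖ.  The plain preimages
-- f⁻¹(Lᵢ) may have facets that are not facets of L′, so they are replaced by the
-- subcomplexes generated by the simplices of L′ all of whose extensions in L′
-- are mapped into Lᵢ; the facets of these are facets of L′.  They still cover L′,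
-- even when some simplices of L′ lie in no facet: enlarge a simplex F until the
-- finite set of those i with f(F) ∈ Lᵢ no longer shrinks.
module Submission where

open import Defs
open import Axiom.ExcludedMiddle using (ExcludedMiddle)
open import Data.Empty using (⊥-elim)
open import Data.Fin.Base using (Fin)
import Data.Irrelevant as Irr
open import Data.Nat.Base using (ℕ; _<_)
open import Data.Nat.Properties using (<⇒≱)
open import Data.Product.Base using (_×_; Σ-syntax; ∃-syntax; _,_; proj₁; proj₂)
import Data.Refinement as Ref
open import Function.Base using (_∘_; id)
open import Level using (Level; Lift; lift; lower; suc)
open import Relation.Binary.Construct.Add.Supremum.Strict _<_ using ([_]; [_]<⊤⁺)
open import Relation.Binary.Core using (Rel)
open import Relation.Binary.Definitions using (Reflexive; Transitive)
open import Relation.Binary.PropositionalEquality.Core using (refl; cong)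
open import Relation.Nullary using (¬_; yes; no)
open import Relation.Nullary.Decidable using (True; toWitness; fromWitness; decidable-stable; map′)
open import Relation.Unary using (Pred; _∈_; _⊆_; _≐_)

open FacetSimplicialMap
open InjectiveFacetSimplicialMap using (facetSimplicialMap; injective)

private
  variable
    ℓ p q : Level
    U : Set ℓ

-- Anything below `n` in the strict order is finite, so `m` comes with a witness for `P`; read as a
-- witness for `Q`, it bounds `n`.
IsLeastPositive-antitone : {P : ℕ → Set p} {Q : ℕ → Set q} → (∀ k → P k → Q k) →
                           ∀ {m n} → IsLeastPositive P m → IsLeastPositive Q n →
                           ¬ (n >⁺ m)
IsLeastPositive-antitone P⇒Q ((0<k , Pk) , _) (_ , least) [ k<l ] =
  <⇒≱ k<l (least _ (0<k , P⇒Q _ Pk))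
IsLeastPositive-antitone P⇒Q ((0<k , Pk) , _) none [ k ]<⊤⁺ =
  none k (0<k , P⇒Q k Pk)

leastPositive-antitone : (em : ExcludedMiddle p) {P Q : ℕ → Set p} → (∀ k → P k → Q k) →
                         ¬ (proj₁ (leastPositive em Q) >⁺ proj₁ (leastPositive em P))
leastPositive-antitone em {P} {Q} P⇒Q =
  IsLeastPositive-antitone P⇒Q (proj₂ (leastPositive em P)) (proj₂ (leastPositive em Q))

lower-em : ExcludedMiddle (suc ℓ) → ExcludedMiddle ℓ
lower-em em = map′ lower lift em

-- The set of indices i with Q i x shrinks as x grows; being finite, it is
-- eventually constant.
eventually-in-one :
  ExcludedMiddle (suc ℓ) → {A : Set (suc ℓ)} {_≤_ : Rel A ℓ} →
  Reflexive _≤_ → Transitive _≤_ →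
  ∀ {k} (Q : Fin k → Pred A ℓ) → (∀ i {x y} → x ≤ y → Q i y → Q i x) →
  ∀ x → (∀ {y} → x ≤ y → ∃[ i ] Q i y) →
  ∃[ i ] ∃[ y ] (x ≤ y × (∀ {z} → y ≤ z → Q i z))
eventually-in-one em ≤-refl ≤-trans {ℕ.zero} Q Q-closed x cover with () , _ ← cover ≤-refl
eventually-in-one em {_≤_ = _≤_} ≤-refl ≤-trans {ℕ.suc k} Q Q-closed x cover
  -- Either index zero fails at some `y` above `x`, hence everywhere above `y` because `Q` is
  -- inherited downwards, and induction drops it; or it never fails and `x` itself serves.
  with em {∃[ y ] (x ≤ y × ¬ Q Fin.zero y)}
... | no none = Fin.zero , x , ≤-refl , λ x≤z →
  decidable-stable (lower-em em) λ ¬Qz → none (_ , x≤z , ¬Qz)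
... | yes (y , x≤y , ¬Qy) =
  let i , z , y≤z , Qi = eventually-in-one em ≤-refl ≤-trans (Q ∘ Fin.suc) (Q-closed ∘ Fin.suc) y cover-suc
  in  Fin.suc i , z , ≤-trans x≤y y≤z , Qi
  where
  cover-suc : ∀ {z} → y ≤ z → ∃[ i ] Q (Fin.suc i) z
  cover-suc y≤z with cover (≤-trans x≤y y≤z)
  ... | Fin.zero , Qz = ⊥-elim (¬Qy (Q-closed Fin.zero y≤z Qz))
  ... | Fin.suc i , Qz = i , Qz

-- Used for composites, whose images agree with iterated images only up to `≐`.
IsNonUnitaryFacet-resp-≐ : (K : SimplicialComplex U) {F G : Pred U _} → F ≐ G →
                           IsNonUnitaryFacet K F → IsNonUnitaryFacet K G
IsNonUnitaryFacet-resp-≐ K (F⊆G , G⊆F) ((F∈K , maximal) , v , w , v∈F , w∈F , v≢w) =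
  (down-closed K F∈K G⊆F , λ E∈K G⊆E → F⊆G ∘ maximal E∈K (G⊆E ∘ F⊆G)) ,
  v , w , F⊆G v∈F , F⊆G w∈F , v≢w

image-mono : {U V : Set ℓ} {L : SimplicialComplex U} {K : SimplicialComplex V}
             (f : Vertex L → Vertex K) →
             {F G : Pred U _} (F∈L : F ∈ simplices L) (G∈L : G ∈ simplices L) → F ⊆ G →
             image L K f F∈L ⊆ image L K f G∈L
image-mono f F∈L G∈L F⊆G (v , v∈F , fv≡w) = v , F⊆G v∈F , fv≡w

module _ {U V W : Set ℓ} {L : SimplicialComplex U} {M : SimplicialComplex V}
  {K : SimplicialComplex W} where

  -- Vertex proofs are irrelevant, so the vertex of `M` read off the image of `F` is definitionally
  -- a value of `f`, and `refl` suffices both ways.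
  image-∘ : (g : Vertex M → Vertex K) (f : Vertex L → Vertex M) →
            ∀ {F} (F∈L : F ∈ simplices L) (fF∈M : image L M f F∈L ∈ simplices M) →
            image M K g fF∈M ≐ image L K (g ∘ f) F∈L
  image-∘ g f F∈L fF∈M =
    (λ { (_ , (v , v∈F , refl) , refl) → v , v∈F , refl }) ,
    (λ { (v , v∈F , refl) → _ , (v , v∈F , refl) , refl })

  _∘ᶠ_ : FacetSimplicialMap M K → FacetSimplicialMap L M → FacetSimplicialMap L K
  (g ∘ᶠ f) .map = map g ∘ map f
  (g ∘ᶠ f) .simplicial F∈L =
    down-closed K (simplicial g (simplicial f F∈L))
      (proj₂ (image-∘ (map g) (map f) F∈L (simplicial f F∈L)))
  (g ∘ᶠ f) .facet F∈L F-facet =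
    IsNonUnitaryFacet-resp-≐ K (image-∘ (map g) (map f) F∈L (simplicial f F∈L))
      (facet g (simplicial f F∈L) (facet f F∈L F-facet))

  _∘ⁱ_ : InjectiveFacetSimplicialMap M K → InjectiveFacetSimplicialMap L M →
         InjectiveFacetSimplicialMap L K
  (g ∘ⁱ f) .facetSimplicialMap = facetSimplicialMap g ∘ᶠ facetSimplicialMap f
  (g ∘ⁱ f) .injective = injective f ∘ injective g

Decomposition-map : {P Q : SimplicialComplex U → Set _} → (∀ {M} → P M → Q M) →
                    (L : SimplicialComplex U) → ∀ k → Decomposition P L k → Decomposition Q L k
Decomposition-map P⇒Q L k (Ls , sub , union , parts) = Ls , sub , union , P⇒Q ∘ parts

module Pullback (em : ExcludedMiddle (suc ℓ)) {U′ U : Set ℓ}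
  {L′ : SimplicialComplex U′} {L : SimplicialComplex U} (f : FacetSimplicialMap L′ L) where

  IsStablyIn : SimplicialComplex U → Pred (Pred U′ ℓ) (suc ℓ)
  IsStablyIn M F = F ∈ simplices L′ ×
    (∀ {G} (G∈L′ : G ∈ simplices L′) → F ⊆ G → image L′ L (map f) G∈L′ ∈ simplices M)

  -- Stability passes to larger simplices of `L′`, not to faces in general; faces are added here to
  -- obtain a complex.
  Generated : SimplicialComplex U → Pred (Pred U′ ℓ) (suc ℓ)
  Generated M F = ∃[ E ] (F ⊆ E × IsStablyIn M E)

  -- Generated M lives one universe too high for a set of simplices; excluded
  -- middle resizes it.
  pullback : SimplicialComplex U → SimplicialComplex U′
  pullback M .simplices F = Lift ℓ (True (em {Generated M F}))
  pullback M .down-closed {G = G} F∈ G⊆F =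
    let E , F⊆E , E-stable = toWitness (lower F∈)
    in  lift (fromWitness {a? = em {Generated M G}} (E , F⊆E ∘ G⊆F , E-stable))

  module _ (M : SimplicialComplex U) where

    generated : ∀ {F} → F ∈ simplices (pullback M) → Generated M F
    generated F∈ = toWitness (lower F∈)

    stable⇒∈pullback : ∀ {F} → IsStablyIn M F → F ∈ simplices (pullback M)
    stable⇒∈pullback F-stable = lift (fromWitness {a? = em {Generated M _}} (_ , id , F-stable))

    pullback-subcomplex : pullback M IsSubcomplexOf L′
    pullback-subcomplex F∈ =
      let _ , F⊆E , E∈L′ , _ = generated F∈ in down-closed L′ E∈L′ F⊆E

    -- `F` lies in a stable `E`, which is one of its own extensions; so the image of `E` is in `M`,
    -- and it contains that of `F`.
    image∈M : ∀ {F} (F∈ : F ∈ simplices (pullback M)) →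
              image L′ L (map f) (pullback-subcomplex F∈) ∈ simplices M
    image∈M F∈ =
      let _ , F⊆E , E∈L′ , E-stable = generated F∈
      in  down-closed M (E-stable E∈L′ id)
            (image-mono {L = L′} {K = L} (map f) (pullback-subcomplex F∈) E∈L′ F⊆E)

    -- By maximality `F` equals a stable simplex `E` containing it. Any simplex of `L′` above `F`
    -- then extends `E`, is itself stable, and so lies in the pullback, where `F` is maximal.
    pullback-facet : ∀ {F} → IsFacet (pullback M) F → IsFacet L′ F
    pullback-facet (F∈ , maximal) = pullback-subcomplex F∈ , λ {G} G∈L′ F⊆G →
      let _ , F⊆E , E-stable@(_ , E-extensions) = generated F∈
          E⊆F = maximal (stable⇒∈pullback E-stable) F⊆E
          G-stable : IsStablyIn M G
          G-stable = G∈L′ , λ H∈L′ G⊆H → E-extensions H∈L′ (G⊆H ∘ F⊆G ∘ E⊆F)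
      in  maximal (stable⇒∈pullback G-stable) F⊆G

    include : Vertex (pullback M) → Vertex L′
    include = Ref.refine λ { (F , F∈ , v∈F) → F , pullback-subcomplex F∈ , v∈F }

    restrictVertex : Vertex (pullback M) → Vertex M
    restrictVertex v = Ref.value (map f (include v)) Ref.,
      -- The image of `F` is a simplex of `M` through the new vertex.
      Irr.map (λ { (F , F∈ , v∈F) → _ , image∈M F∈ , _ , v∈F , refl }) (Ref.proof v)

    restrict : M IsSubcomplexOf L → FacetSimplicialMap (pullback M) M
    restrict M⊆L .map = restrictVertex
    restrict M⊆L .simplicial F∈ = image∈M F∈
    restrict M⊆L .facet F∈ (F-facet , F-nonunitary) =
      let (_ , maximal) , image-nonunitary =
            facet f (pullback-subcomplex F∈) (pullback-facet F-facet , F-nonunitary)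
      -- Maximality in `L` restricts to `M`, whose simplices all belong to `L`.
      in  (image∈M F∈ , λ G∈M → maximal (M⊆L G∈M)) , image-nonunitary

  pullback-cover : ∀ {k} (Ls : Fin k → SimplicialComplex U) → simplices L ⊆ simplices (⋃ Ls) →
                   simplices L′ ⊆ simplices (⋃ (pullback ∘ Ls))
  pullback-cover Ls cover {F} F∈L′ =
    let i , (E , E∈L′) , F⊆E , E-extensions =
          eventually-in-one em
            -- Simplices carry their membership proofs because `image` takes one.
            {A = Σ[ G ∈ Pred U′ ℓ ] G ∈ simplices L′}
            {_≤_ = λ G H → proj₁ G ⊆ proj₁ H}
            id (λ G⊆H H⊆I → H⊆I ∘ G⊆H)
            (λ i G → image L′ L (map f) (proj₂ G) ∈ simplices (Ls i))
            (λ i {G} {H} G⊆H fH∈Lᵢ → down-closed (Ls i) fH∈Lᵢ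
              (image-mono {L = L′} {K = L} (map f) (proj₂ G) (proj₂ H) G⊆H))
            (F , F∈L′)
            (λ {G} _ → cover (simplicial f (proj₂ G)))
    in  i , down-closed (pullback (Ls i))
              (stable⇒∈pullback (Ls i) (E∈L′ , λ G∈L′ → E-extensions {_ , G∈L′})) F⊆E

  pullback-decomposition :
    {P : SimplicialComplex U → Set (suc ℓ)} {Q : SimplicialComplex U′ → Set (suc ℓ)} →
    (∀ M → M IsSubcomplexOf L → P M → Q (pullback M)) →
    ∀ k → Decomposition P L k → Decomposition Q L′ k
  pullback-decomposition P⇒Q k (Ls , sub , (cover , _) , parts) =
    pullback ∘ Ls ,
    (λ i → pullback-subcomplex (Ls i)) ,
    (pullback-cover Ls cover , λ { (i , F∈) → pullback-subcomplex (Ls i) F∈ }) ,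
    λ i → P⇒Q (Ls i) (sub i) (parts i)

restrictⁱ : (em : ExcludedMiddle (suc ℓ)) {U′ U : Set ℓ}
  {L′ : SimplicialComplex U′} {L : SimplicialComplex U} (f : InjectiveFacetSimplicialMap L′ L) →
  let open Pullback em (facetSimplicialMap f) in
  ∀ M → M IsSubcomplexOf L → InjectiveFacetSimplicialMap (pullback M) M
restrictⁱ em f M M⊆L .facetSimplicialMap = Pullback.restrict em (facetSimplicialMap f) M M⊆L
restrictⁱ em f M M⊆L .injective rv≡rw =
  -- Vertices are equal once their values are: this lifts the equation from `M` to `L`, where
  -- injectivity of `f` applies, and then returns from `L′` to the pullback.
  Ref.value-injective (cong Ref.value (injective f (Ref.value-injective (cong Ref.value rv≡rw))))

proposition3p10 : ∀ {ℓ : Level} (em : ExcludedMiddle (suc ℓ)) →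
    ({U U′ : Set ℓ} (L : SimplicialComplex U) (L′ : SimplicialComplex U′) →
    ((Σ[ W ∈ Set ℓ ] Σ[ H ∈ SimplicialComplex W ] C em L′ H >⁺ C em L H) →
    ¬ FacetSimplicialMap L′ L)
    ×
    ((Σ[ W ∈ Set ℓ ] Σ[ H ∈ SimplicialComplex W ] IC em L′ H >⁺ IC em L H) →
    ¬ InjectiveFacetSimplicialMap L′ L))
    ×
    ({W W′ : Set ℓ} (H : SimplicialComplex W) (H′ : SimplicialComplex W′) →
    ((Σ[ U ∈ Set ℓ ] Σ[ L ∈ SimplicialComplex U ] C em L H >⁺ C em L H′) →
    ¬ FacetSimplicialMap H′ H)
    ×
    ((Σ[ U ∈ Set ℓ ] Σ[ L ∈ SimplicialComplex U ] IC em L H >⁺ IC em L H′) →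
    ¬ InjectiveFacetSimplicialMap H′ H))
proposition3p10 em =
  (λ L L′ →
    (λ (_ , H , C>C) f → let open Pullback em f in
      -- Each piece of `L` is replaced by its pullback, mapped to `H` by way of that piece, so `L′`
      -- splits into equally many pieces.
      leastPositive-antitone em
        (pullback-decomposition
          {P = λ M → FacetSimplicialMap M H} {Q = λ M → FacetSimplicialMap M H}
          λ M M⊆L g → g ∘ᶠ restrict M M⊆L) C>C) ,
    (λ (_ , H , IC>IC) f → let open Pullback em (facetSimplicialMap f) in
      leastPositive-antitone em
        (pullback-decomposition
          {P = λ M → InjectiveFacetSimplicialMap M H} {Q = λ M → InjectiveFacetSimplicialMap M H}
          λ M M⊆L g → g ∘ⁱ restrictⁱ em f M M⊆L) IC>IC)) ,
  (λ H H′ →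
    -- Here the pieces of `L` are kept and only their maps change.
    (λ (_ , L , C>C) f → leastPositive-antitone em
      (Decomposition-map
        {P = λ M → FacetSimplicialMap M H′} {Q = λ M → FacetSimplicialMap M H}
        (f ∘ᶠ_) L) C>C) ,
    (λ (_ , L , IC>IC) f → leastPositive-antitone em
      (Decomposition-map
        {P = λ M → InjectiveFacetSimplicialMap M H′} {Q = λ M → InjectiveFacetSimplicialMap M H}
        (f ∘ⁱ_) L) IC>IC))
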